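{- Let $\mathbb C$ be a (strict) Cartesian differential category with differential operator $D$. For any morphism $(i,\mathbf f):\mathbf A\to\mathbf B$ in $\mathrm{St}(\mathbb C)$ and any $k\in\mathbb N$, $$\mathrm{Un}_k(\mathcal D^*(i,\mathbf f))=D(\mathrm{Un}_k(i,\mathbf f))\circ z:\prod_{n=0}^k(\mathbf A_n\times\mathbf A_n)\to\mathbf B_k,$$ where $z:\prod_{n=0}^k(\mathbf A_n\times\mathbf A_n)\to\big(\prod_{n=0}^k\mathbf A_n\big)\times\big(\prod_{n=0}^k\mathbf A_n\big)$ is the unzipping isomorphism $(x_0,y_0,\dots,x_k,y_k)\mapsto(x_0,\dots,x_k,y_0,\dots,y_k)$.
   Context: Categories are Cartesian with strictly associative and unital chosen products $\times$, terminal object $1$, $!_X:X\to1$, diagonal $\Delta_X$, symmetry $\sigma_{X,Y}:X\times Y\to Y\times X$. An object's name also denotes its identity morphism. Equations may be written with generalized elements. $[e_k]_k$ denotes the $\mathbb N$-indexed sequence with entries $e_k$. Left additive category: a Cartesian category in which every object $X$ carries a designated commutative monoid structure $+_X:X\times X\to X$, $0_X:1\to X$ such that $0_{X\times Y}=0_X\times0_Y$ and $+_{X\times Y}=(+_X\times+_Y)\circ(X\times\sigma_{Y,X}\times Y)$. Notation: $\delta_{X,Y}=X\times\sigma_{Y,X}\times Y$; $\alpha_X=\delta_{X,X}\circ(X\times X\times\Delta_X)$; $\zeta_X=X\times0_{X\times X}\times X:X\times X\to X^4$. Cartesian differential category: a left additive category with a Cartesian differential operator, i.e. functions $D:\mathbb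 C(X,Y)\to\mathbb C(X\times X,Y)$ such that for all $f:X\to Y$, $g:Y\to Z$, $h:V\to W$: CD1. $Ds=s\times{!_{\mathrm{dom}(s)}}$ for $s\in\{\mathrm{id}_X,\sigma_{X,Y},!_X,\Delta_X,+_X,0_X\}$; CD2. $Df\circ(0_X\times X)=0_Y\circ{!_X}$; CD3. $Df\circ(+_X\times X)=+_Y\circ(Df\times Df)\circ\alpha_X$; CD4. $D(g\circ f)=Dg\circ(Df\times f)\circ(X\times\Delta_X)$; CD5. $D(f\times h)=(Df\times Dh)\circ\delta_{X,V}$; CD6. $DDf\circ\zeta_X=Df$; CD7. $DDf\circ\delta_{X,X}=DDf$. 2-cells: a 2-cell $f$ consists of objects $S=\mathrm{prv}\,f$, $X=\mathrm{dom}\,f$, $S'=\mathrm{nxt}\,f$, $Y=\mathrm{cod}\,f$ together with an underlying morphism $Uf:S\times X\to S'\times Y$ in $\mathbb C$. Vertical composition: if $h$ has $Uh:S'\times V\to S''\times W$, then $f;h$ has $\mathrm{prv}=S$, $\mathrm{dom}=X\times V$, $\mathrm{nxt}=S''$, $\mathrm{cod}=Y\times W$ and $U(f;h)(s,x,v)=(s'',y,w)$ where $(s',y)=Uf(s,x)$, $(s'',w)=Uh(s',v)$. For $\phi:X\to Y$ in $\mathbb C$, $\phi^v$ is the 2-cell with underlying morphism $\phi$, $\mathrm{prv}=X$, $\mathrm{nxt}=Y$, $\mathrm{dom}=\mathrm{cod}=1$. Stateful morphism sequences: for $\mathbf A,\mathbf B\in|\mathbb C|^{\mathbb N}$, a stateful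 morphism sequence $(i,\mathbf s):\mathbf A\to\mathbf B$ is a sequence $\mathbf s$ of 2-cells with $\mathrm{dom}\,\mathbf s_k=\mathbf A_k$, $\mathrm{cod}\,\mathbf s_k=\mathbf B_k$, $\mathrm{nxt}\,\mathbf s_k=\mathrm{prv}\,\mathbf s_{k+1}$ for all $k$, and a morphism $i:1\to\mathrm{prv}\,\mathbf s_0$. Its $n$th truncation is $\mathrm{Tc}_n(i,\mathbf s)=U(i^v;\mathbf s_0;\cdots;\mathbf s_n;(!_{\mathrm{nxt}\,\mathbf s_n})^v):\prod_{k=0}^n\mathbf A_k\to\prod_{k=0}^n\mathbf B_k$, and its $k$th unrolling is $\mathrm{Un}_k(i,\mathbf s)=\pi_k\circ\mathrm{Tc}_k(i,\mathbf s):\prod_{n=0}^k\mathbf A_n\to\mathbf B_k$, with $\pi_k$ the projection onto $\mathbf B_k$. Two stateful morphism sequences are extensionally equal if all their truncations agree. The category $\mathrm{St}(\mathbb C)$ has objects $|\mathbb C|^{\mathbb N}$ and morphisms the extensional equivalence classes of stateful morphism sequences; $\mathrm{Tc}$ and $\mathrm{Un}$ are well defined on its morphisms. Products of objects in it are componentwise. The operation $\mathcal D$ on 2-cells: for $f$ with $Uf:S\times X\to S'\times Y$, $\mathcal Df$ is the 2-cell with $\mathrm{prv}=S\times S$, $\mathrm{dom}=X\times X$, $\mathrm{nxt}=S'\times S'$, $\mathrm{cod}=Y$ and $U(\mathcal Df)(\dot s,s,\dot x,x)=(\dot s',s',\dot y)$, where $(\dot s',\dot y)=D(Uf)(\dot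 s,\dot x,s,x)$ and $s'$ is the $S'$-component of $Uf(s,x)$. The operation $\mathcal D^*:\mathrm{St}(\mathbb C)(\mathbf A,\mathbf B)\to\mathrm{St}(\mathbb C)(\mathbf A\times\mathbf A,\mathbf B)$ is $\mathcal D^*(i,\mathbf s)=(U\mathcal D(i^v),[\mathcal D\mathbf s_k]_k)$ (well defined on extensional equivalence classes). -}

module Defs where

open import Level using (Level; suc; _⊔_)
open import Data.Nat using (ℕ) renaming (zero to zeroᴺ; suc to sucᴺ)
open import Relation.Binary.Bundles using (Setoid)
open import Relation.Binary.PropositionalEquality using (_≡_; refl)
open import Relation.Binary.Structures using (IsEquivalence)

record Category (o ℓ e : Level) : Set (suc (o ⊔ ℓ ⊔ e)) where
  infix  4 _≈_ _⇒_
  infixr 9 _∘_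
  field
    Obj       : Set o
    _⇒_       : Obj → Obj → Set ℓ
    _≈_       : ∀ {X Y} → X ⇒ Y → X ⇒ Y → Set e
    id        : ∀ {X} → X ⇒ X
    _∘_       : ∀ {X Y Z} → Y ⇒ Z → X ⇒ Y → X ⇒ Z
    equiv     : ∀ {X Y} → IsEquivalence (_≈_ {X} {Y})
    assoc     : ∀ {W X Y Z} {f : W ⇒ X} {g : X ⇒ Y} {h : Y ⇒ Z} →
                (h ∘ g) ∘ f ≈ h ∘ (g ∘ f)
    identityˡ : ∀ {X Y} {f : X ⇒ Y} → id ∘ f ≈ f
    identityʳ : ∀ {X Y} {f : X ⇒ Y} → f ∘ id ≈ f
    ∘-resp-≈  : ∀ {X Y Z} {f f′ : X ⇒ Y} {g g′ : Y ⇒ Z} →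
                g ≈ g′ → f ≈ f′ → g ∘ f ≈ g′ ∘ f′

  cast : ∀ {X Y} → X ≡ Y → X ⇒ Y
  cast refl = id

record CartesianCategory (o ℓ e : Level) : Set (suc (o ⊔ ℓ ⊔ e)) where
  infixr 7 _×_
  field
    category : Category o ℓ e
  open Category category public
  field
    𝟙        : Obj
    !        : ∀ {X} → X ⇒ 𝟙
    !-unique : ∀ {X} (f : X ⇒ 𝟙) → f ≈ !
    _×_      : Obj → Obj → Obj
    π₁       : ∀ {X Y} → X × Y ⇒ X
    π₂       : ∀ {X Y} → X × Y ⇒ Y
    ⟨_,_⟩    : ∀ {W X Y} → W ⇒ X → W ⇒ Y → W ⇒ X × Y
    project₁ : ∀ {W X Y} {f : W ⇒ X} {g : W ⇒ Y} → π₁ ∘ ⟨ f , g ⟩ ≈ f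
    project₂ : ∀ {W X Y} {f : W ⇒ X} {g : W ⇒ Y} → π₂ ∘ ⟨ f , g ⟩ ≈ g
    ⟨⟩-unique : ∀ {W X Y} {f : W ⇒ X} {g : W ⇒ Y} {h : W ⇒ X × Y} →
                π₁ ∘ h ≈ f → π₂ ∘ h ≈ g → ⟨ f , g ⟩ ≈ h

  infixr 8 _×₁_
  _×₁_ : ∀ {X X′ Y Y′} → X ⇒ X′ → Y ⇒ Y′ → X × Y ⇒ X′ × Y′
  f ×₁ g = ⟨ f ∘ π₁ , g ∘ π₂ ⟩

  Δ : ∀ {X} → X ⇒ X × X
  Δ = ⟨ id , id ⟩

  σ : ∀ {X Y} → X × Y ⇒ Y × X
  σ = ⟨ π₂ , π₁ ⟩

  assʳ : ∀ {X Y Z} → (X × Y) × Z ⇒ X × (Y × Z)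
  assʳ = ⟨ π₁ ∘ π₁ , ⟨ π₂ ∘ π₁ , π₂ ⟩ ⟩

  assˡ : ∀ {X Y Z} → X × (Y × Z) ⇒ (X × Y) × Z
  assˡ = ⟨ ⟨ π₁ , π₁ ∘ π₂ ⟩ , π₂ ∘ π₂ ⟩

  λ⇒ : ∀ {X} → 𝟙 × X ⇒ X
  λ⇒ = π₂

  λ⇐ : ∀ {X} → X ⇒ 𝟙 × X
  λ⇐ = ⟨ ! , id ⟩

  ρ⇒ : ∀ {X} → X × 𝟙 ⇒ X
  ρ⇒ = π₁

  ρ⇐ : ∀ {X} → X ⇒ X × 𝟙
  ρ⇐ = ⟨ id , ! ⟩

  -- X × σ × Y′ for σ : Y × X′ → X′ × Y, that is (x , y , x′ , y′) ↦ (x , x′ , y , y′).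
  interchange : ∀ {X Y X′ Y′} → (X × Y) × (X′ × Y′) ⇒ (X × X′) × (Y × Y′)
  interchange = assˡ ∘ (id ×₁ (assʳ ∘ (σ ×₁ id) ∘ assˡ)) ∘ assʳ

  δ : ∀ {X Y} → (X × Y) × (X × Y) ⇒ (X × X) × (Y × Y)
  δ = interchange

  α : ∀ {X} → (X × X) × X ⇒ (X × X) × (X × X)
  α = δ ∘ (id ×₁ Δ)

-- Strictness of the chosen products: objects associate and are unital on the
-- nose, and the canonical isomorphisms are the identities.  Equality of objects
-- is propositional, so an "identity" between equal objects is a `cast`.  Below,
-- the canonical isomorphisms assʳ, assˡ, λ⇒, λ⇐, ρ⇒, ρ⇐ appear wherever
-- informal strict notation suppresses an identity.
record IsStrict {o ℓ e} (C : CartesianCategory o ℓ e) : Set (o ⊔ ℓ ⊔ e) where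
  open CartesianCategory C
  field
    ×-assoc     : ∀ X Y Z → (X × Y) × Z ≡ X × (Y × Z)
    ×-identityˡ : ∀ X → 𝟙 × X ≡ X
    ×-identityʳ : ∀ X → X × 𝟙 ≡ X
    assʳ-strict : ∀ {X Y Z} → assʳ {X} {Y} {Z} ≈ cast (×-assoc X Y Z)
    λ⇒-strict   : ∀ {X} → λ⇒ {X} ≈ cast (×-identityˡ X)
    ρ⇒-strict   : ∀ {X} → ρ⇒ {X} ≈ cast (×-identityʳ X)

record LeftAdditiveCategory (o ℓ e : Level) : Set (suc (o ⊔ ℓ ⊔ e)) where
  field
    cartesian : CartesianCategory o ℓ e
    isStrict  : IsStrict cartesian
  open CartesianCategory cartesian public
  open IsStrict isStrict public
  field
    plus : ∀ X → X × X ⇒ X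
    zero : ∀ X → 𝟙 ⇒ X

    plus-assoc     : ∀ {X} → plus X ∘ (plus X ×₁ id) ≈ plus X ∘ (id ×₁ plus X) ∘ assʳ
    plus-identityˡ : ∀ {X} → plus X ∘ (zero X ×₁ id) ≈ λ⇒
    plus-identityʳ : ∀ {X} → plus X ∘ (id ×₁ zero X) ≈ ρ⇒
    plus-comm      : ∀ {X} → plus X ∘ σ ≈ plus X

    zero-× : ∀ {X Y} → zero (X × Y) ≈ (zero X ×₁ zero Y) ∘ λ⇐
    plus-× : ∀ {X Y} → plus (X × Y) ≈ (plus X ×₁ plus Y) ∘ interchange

  -- X × 0 × X, that is (x , y) ↦ (x , 0 , 0 , y).
  ζ : ∀ {X} → X × X ⇒ (X × X) × (X × X)
  ζ {X} = assˡ ∘ (id ×₁ assʳ) ∘ (id ×₁ (zero (X × X) ×₁ id)) ∘ (id ×₁ λ⇐)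

record CartesianDifferentialCategory (o ℓ e : Level) : Set (suc (o ⊔ ℓ ⊔ e)) where
  field
    leftAdditive : LeftAdditiveCategory o ℓ e
  open LeftAdditiveCategory leftAdditive public
  field
    D      : ∀ {X Y} → X ⇒ Y → X × X ⇒ Y
    D-cong : ∀ {X Y} {f g : X ⇒ Y} → f ≈ g → D f ≈ D g

    CD1-id   : ∀ {X} → D (id {X}) ≈ ρ⇒ ∘ (id ×₁ !)
    CD1-σ    : ∀ {X Y} → D (σ {X} {Y}) ≈ ρ⇒ ∘ (σ ×₁ !)
    CD1-!    : ∀ {X} → D (! {X}) ≈ ρ⇒ ∘ (! ×₁ !)
    CD1-Δ    : ∀ {X} → D (Δ {X}) ≈ ρ⇒ ∘ (Δ ×₁ !)
    CD1-plus : ∀ {X} → D (plus X) ≈ ρ⇒ ∘ (plus X ×₁ !)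
    CD1-zero : ∀ {X} → D (zero X) ≈ ρ⇒ ∘ (zero X ×₁ !)
    CD2 : ∀ {X Y} {f : X ⇒ Y} → D f ∘ (zero X ×₁ id) ≈ zero Y ∘ !
    CD3 : ∀ {X Y} {f : X ⇒ Y} →
          D f ∘ (plus X ×₁ id) ≈ plus Y ∘ (D f ×₁ D f) ∘ α
    CD4 : ∀ {X Y Z} {f : X ⇒ Y} {g : Y ⇒ Z} →
          D (g ∘ f) ≈ D g ∘ (D f ×₁ f) ∘ assˡ ∘ (id ×₁ Δ)
    CD5 : ∀ {X Y V W} {f : X ⇒ Y} {h : V ⇒ W} →
          D (f ×₁ h) ≈ (D f ×₁ D h) ∘ δ
    CD6 : ∀ {X Y} {f : X ⇒ Y} → D (D f) ∘ ζ ≈ D f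
    CD7 : ∀ {X Y} {f : X ⇒ Y} → D (D f) ∘ δ ≈ D (D f)

module Stateful {o ℓ e} (C : CartesianCategory o ℓ e) where
  open CartesianCategory C

  record TwoCell (prv dom nxt cod : Obj) : Set ℓ where
    constructor cell
    field
      U : prv × dom ⇒ nxt × cod

  open TwoCell public

  -- (s , x , v) ↦ (s″ , y , w) where (s′ , y) = U f (s , x), (s″ , w) = U h (s′ , v).
  infixl 5 _⨾_
  _⨾_ : ∀ {S S′ S″ X Y V W} →
        TwoCell S X S′ Y → TwoCell S′ V S″ W → TwoCell S (X × V) S″ (Y × W)
  U (_⨾_ {S} {S′} {S″} {X} {Y} {V} {W} f h) =
    ⟨ π₁ ∘ s″w , ⟨ π₂ ∘ s′y , π₂ ∘ s″w ⟩ ⟩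
    where
    s′y : S × (X × V) ⇒ S′ × Y
    s′y = U f ∘ ⟨ π₁ , π₁ ∘ π₂ ⟩
    s″w : S × (X × V) ⇒ S″ × W
    s″w = U h ∘ ⟨ π₁ ∘ s′y , π₂ ∘ π₂ ⟩

  infix 10 _ᵛ
  _ᵛ : ∀ {X Y} → X ⇒ Y → TwoCell X 𝟙 Y 𝟙
  U (φ ᵛ) = φ ×₁ id

  Seq : Set o
  Seq = ℕ → Obj

  infixr 7 _×ˢ_
  _×ˢ_ : Seq → Seq → Seq
  (A ×ˢ B) k = A k × B k

  -- ∏ A n is the product of the first n entries A 0 , … , A (n - 1); the product
  -- of A 0 , … , A k is ∏ A (k + 1), where the leading 𝟙 is absorbed by strictness.
  ∏ : Seq → ℕ → Obj
  ∏ A zeroᴺ    = 𝟙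
  ∏ A (sucᴺ n) = ∏ A n × A n

  -- Entry k of `cells` has previous state `state k` and next state
  -- `state (k + 1)`, so consecutive cells match by typing.
  record StatefulSequence (A B : Seq) : Set (o ⊔ ℓ) where
    field
      state : Seq
      init  : 𝟙 ⇒ state 0
      cells : ∀ k → TwoCell (state k) (A k) (state (sucᴺ k)) (B k)

  module _ {A B : Seq} where

    -- initᵛ ⨾ cells 0 ⨾ ⋯ ⨾ cells (n - 1)
    composite : (f : StatefulSequence A B) (n : ℕ) →
                TwoCell 𝟙 (∏ A n) (StatefulSequence.state f n) (∏ B n)
    composite f zeroᴺ    = StatefulSequence.init f ᵛ
    composite f (sucᴺ n) = composite f n ⨾ StatefulSequence.cells f n

    Tc : (n : ℕ) → StatefulSequence A B → ∏ A (sucᴺ n) ⇒ ∏ B (sucᴺ n)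
    Tc n f = ρ⇒ ∘ λ⇒ ∘ U (composite f (sucᴺ n) ⨾ ! ᵛ) ∘ λ⇐ ∘ ρ⇐

    Un : (k : ℕ) → StatefulSequence A B → ∏ A (sucᴺ k) ⇒ B k
    Un k f = π₂ ∘ Tc k f

    infix 4 _≋_
    _≋_ : StatefulSequence A B → StatefulSequence A B → Set e
    f ≋ g = ∀ n → Tc n f ≈ Tc n g

    Un-cong : ∀ k {f g} → f ≋ g → Un k f ≈ Un k g
    Un-cong k f≋g = ∘-resp-≈ (IsEquivalence.refl equiv) (f≋g k)

  -- The hom-setoids of St(C): morphisms are stateful sequences up to
  -- extensional equality.
  St : Seq → Seq → Setoid (o ⊔ ℓ) e
  St A B = record
    { Carrier       = StatefulSequence A B
    ; _≈_           = _≋_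
    ; isEquivalence = record
      { refl  = λ n → IsEquivalence.refl equiv
      ; sym   = λ p n → IsEquivalence.sym equiv (p n)
      ; trans = λ p q n → IsEquivalence.trans equiv (p n) (q n)
      }
    }

  -- (x₀ , y₀ , … , xₖ , yₖ) ↦ (x₀ , … , xₖ , y₀ , … , yₖ)
  unzip : ∀ A B n → ∏ (A ×ˢ B) n ⇒ ∏ A n × ∏ B n
  unzip A B zeroᴺ    = ⟨ ! , ! ⟩
  unzip A B (sucᴺ n) = ⟨ (π₁ ∘ unzip A B n) ×₁ π₁ , (π₂ ∘ unzip A B n) ×₁ π₂ ⟩

module Differential {o ℓ e} (C : CartesianDifferentialCategory o ℓ e) where
  open CartesianDifferentialCategory C public
  open Stateful cartesian public

  -- (ṡ , s , ẋ , x) ↦ (ṡ′ , s′ , ẏ) where (ṡ′ , ẏ) = D (U f) (ṡ , ẋ , s , x)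
  -- and s′ is the state component of U f (s , x).
  𝒟 : ∀ {S S′ X Y} → TwoCell S X S′ Y → TwoCell (S × S) (X × X) (S′ × S′) Y
  U (𝒟 {S} {S′} {X} {Y} f) = ⟨ ⟨ π₁ ∘ ṡ′ẏ , s′ ⟩ , π₂ ∘ ṡ′ẏ ⟩
    where
    ṡ : (S × S) × (X × X) ⇒ S
    ṡ = π₁ ∘ π₁
    s : (S × S) × (X × X) ⇒ S
    s = π₂ ∘ π₁
    ẋ : (S × S) × (X × X) ⇒ X
    ẋ = π₁ ∘ π₂
    x : (S × S) × (X × X) ⇒ X
    x = π₂ ∘ π₂
    ṡ′ẏ : (S × S) × (X × X) ⇒ S′ × Y
    ṡ′ẏ = D (U f) ∘ ⟨ ⟨ ṡ , ẋ ⟩ , ⟨ s , x ⟩ ⟩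
    s′ : (S × S) × (X × X) ⇒ S′
    s′ = π₁ ∘ U f ∘ ⟨ s , x ⟩

  -- Given on representatives of morphisms of St(C).
  𝒟* : ∀ {A B} → Setoid.Carrier (St A B) → Setoid.Carrier (St (A ×ˢ A) B)
  𝒟* f = record
    { state = state ×ˢ state
    ; init  = ρ⇒ ∘ U (𝒟 (init ᵛ)) ∘ (λ⇐ ×₁ λ⇐) ∘ λ⇐
    ; cells = λ k → 𝒟 (cells k)
    }
    where open StatefulSequence f

{-# OPTIONS --safe #-}
module Submission where

-- By the chain rule, 𝒟 (f ⨾ h) is 𝒟 f ⨾ 𝒟 h up to reordering the inputs, so by
-- induction the composite of the cells of 𝒟* f is 𝒟 applied to the composite of
-- the cells of f, after unzipping.  Projecting to the last output removes the
-- states.  The induction steps are equations between terms in pairings,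
-- projections, D and opaque morphisms; they are decided by evaluating both sides
-- at generalized elements, D acting on pairs of a tangent and a point.

open import Defs
open import Level using (Level; _⊔_)
open import Data.Nat using (ℕ; suc) renaming (zero to zeroᴺ)
open import Data.Product using (_,_; proj₁; proj₂) renaming (_×_ to _∧_)
open import Data.Unit.Polymorphic using (⊤; tt)
open import Relation.Binary.Bundles using (Setoid)
open import Relation.Binary.PropositionalEquality using (_≡_; refl; cong)
import Relation.Binary.Reasoning.Setoid as SetoidReasoning
open import Relation.Binary.Structures using (IsEquivalence)

-- Pairings and the terminal object: congruence, fusion and uniqueness.

module CartesianProperties {o ℓ e} (C : CartesianCategory o ℓ e) where
  open CartesianCategory C

  hom : Obj → Obj → Setoid ℓ e
  hom X Y = record { Carrier = X ⇒ Y ; _≈_ = _≈_ ; isEquivalence = equiv }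

  module _ {X Y : Obj} where
    open IsEquivalence (equiv {X} {Y}) public
      renaming (refl to ≈-refl; sym to ≈-sym; trans to ≈-trans; reflexive to ≈-reflexive)
    open SetoidReasoning (hom X Y) public

  ∘-congˡ : ∀ {X Y Z} {g : Y ⇒ Z} {f f′ : X ⇒ Y} → f ≈ f′ → g ∘ f ≈ g ∘ f′
  ∘-congˡ = ∘-resp-≈ ≈-refl

  ∘-congʳ : ∀ {X Y Z} {g g′ : Y ⇒ Z} {f : X ⇒ Y} → g ≈ g′ → g ∘ f ≈ g′ ∘ f
  ∘-congʳ p = ∘-resp-≈ p ≈-refl

  ⟨⟩-cong : ∀ {W X Y} {f f′ : W ⇒ X} {g g′ : W ⇒ Y} →
            f ≈ f′ → g ≈ g′ → ⟨ f , g ⟩ ≈ ⟨ f′ , g′ ⟩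
  ⟨⟩-cong p q = ⟨⟩-unique (≈-trans project₁ (≈-sym p)) (≈-trans project₂ (≈-sym q))

  ⟨⟩-∘ : ∀ {V W X Y} {f : W ⇒ X} {g : W ⇒ Y} {h : V ⇒ W} →
         ⟨ f , g ⟩ ∘ h ≈ ⟨ f ∘ h , g ∘ h ⟩
  ⟨⟩-∘ = ≈-sym (⟨⟩-unique (≈-trans (≈-sym assoc) (∘-congʳ project₁))
                          (≈-trans (≈-sym assoc) (∘-congʳ project₂)))

  ⟨⟩-η : ∀ {W X Y} {h : W ⇒ X × Y} → ⟨ π₁ ∘ h , π₂ ∘ h ⟩ ≈ h
  ⟨⟩-η = ⟨⟩-unique ≈-refl ≈-refl

  !-unique₂ : ∀ {X} {f g : X ⇒ 𝟙} → f ≈ g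
  !-unique₂ = ≈-trans (!-unique _) (≈-sym (!-unique _))

-- Derivatives of composites, projections and pairings.

module DifferentialProperties {o ℓ e} (C : CartesianDifferentialCategory o ℓ e) where
  open CartesianDifferentialCategory C
  open CartesianProperties cartesian

  -- `assˡ ∘ (id ×₁ Δ)` keeps the tangent and the point and copies the point, so the right side of
  -- `CD4` is a plain pairing; `h` is later `D f`.
  dup-second : ∀ {X Y} {f : X ⇒ Y} {Z} {h : X × X ⇒ Z} →
               (h ×₁ f) ∘ assˡ ∘ (id ×₁ Δ) ≈ ⟨ h , f ∘ π₂ ⟩
  dup-second {X} {f = f} {h = h} = begin
    (h ×₁ f) ∘ assˡ ∘ (id ×₁ Δ)        ≈⟨ ∘-congˡ assˡ-dup ⟩
    (h ×₁ f) ∘ ⟨ id , π₂ ⟩             ≈⟨ ⟨⟩-∘ ⟩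
    ⟨ (h ∘ π₁) ∘ ⟨ id , π₂ ⟩ , (f ∘ π₂) ∘ ⟨ id , π₂ ⟩ ⟩
      ≈⟨ ⟨⟩-cong (≈-trans assoc (≈-trans (∘-congˡ project₁) identityʳ))
                 (≈-trans assoc (∘-congˡ project₂)) ⟩
    ⟨ h , f ∘ π₂ ⟩                     ∎
    where
    π₂-dup : π₂ ∘ (id {X} ×₁ Δ {X}) ≈ ⟨ π₂ , π₂ ⟩
    π₂-dup = ≈-trans project₂ (≈-trans ⟨⟩-∘ (⟨⟩-cong identityˡ identityˡ))

    assˡ-dup : assˡ ∘ (id ×₁ Δ) ≈ ⟨ id , π₂ {X} {X} ⟩
    assˡ-dup = ≈-trans ⟨⟩-∘ (⟨⟩-cong
      (≈-trans ⟨⟩-∘ (⟨⟩-unique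
        (≈-trans identityʳ (≈-sym (≈-trans project₁ identityˡ)))
        (≈-trans identityʳ (≈-sym (≈-trans assoc (≈-trans (∘-congˡ π₂-dup) project₁))))))
      (≈-trans assoc (≈-trans (∘-congˡ π₂-dup) project₂)))

  D-∘ : ∀ {X Y Z} {f : X ⇒ Y} {g : Y ⇒ Z} → D (g ∘ f) ≈ D g ∘ ⟨ D f , f ∘ π₂ ⟩
  D-∘ = ≈-trans CD4 (∘-congˡ dup-second)

  D-id : ∀ {X} → D (id {X}) ≈ π₁
  D-id = ≈-trans CD1-id (≈-trans project₁ identityˡ)

  D-cast : ∀ {X Y} (p : X ≡ Y) → D (cast p) ≈ cast p ∘ π₁
  D-cast refl = ≈-trans D-id (≈-sym identityˡ)

  -- The hypothesis expresses linearity of `g`: its derivative applies `g` to the tangent and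
  -- ignores the point, which removes the point argument from the chain rule.
  D-linear-∘ : ∀ {X Y Z} {f : X ⇒ Y} {g : Y ⇒ Z} →
               D g ≈ g ∘ π₁ → D (g ∘ f) ≈ g ∘ D f
  D-linear-∘ {f = f} {g} lin = begin
    D (g ∘ f)                     ≈⟨ D-∘ ⟩
    D g ∘ ⟨ D f , f ∘ π₂ ⟩        ≈⟨ ∘-congʳ lin ⟩
    (g ∘ π₁) ∘ ⟨ D f , f ∘ π₂ ⟩   ≈⟨ assoc ⟩
    g ∘ (π₁ ∘ ⟨ D f , f ∘ π₂ ⟩)   ≈⟨ ∘-congˡ project₁ ⟩
    g ∘ D f                       ∎

  -- Strictness makes the unitors casts, whose derivative is given by CD1 for id.
  D-ρ⇒ : ∀ {X} → D (ρ⇒ {X}) ≈ ρ⇒ ∘ π₁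
  D-ρ⇒ {X} = ≈-trans (D-cong ρ⇒-strict) (≈-trans (D-cast (×-identityʳ X)) (∘-congʳ (≈-sym ρ⇒-strict)))

  π₁-π₁-δ : ∀ {X Y} → π₁ ∘ (π₁ ∘ δ {X} {Y}) ≈ π₁ ∘ π₁
  π₁-π₁-δ {X} {Y} = begin
    π₁ ∘ (π₁ ∘ (assˡ ∘ (id ×₁ m) ∘ assʳ))        ≈⟨ ∘-congˡ assoc ⟨
    π₁ ∘ ((π₁ ∘ assˡ) ∘ (id ×₁ m) ∘ assʳ)        ≈⟨ assoc ⟨
    (π₁ ∘ (π₁ ∘ assˡ)) ∘ (id ×₁ m) ∘ assʳ        ≈⟨ ∘-congʳ (≈-trans (∘-congˡ project₁) project₁) ⟩
    π₁ ∘ (id ×₁ m) ∘ assʳ                        ≈⟨ assoc ⟨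
    (π₁ ∘ (id ×₁ m)) ∘ assʳ                      ≈⟨ ∘-congʳ (≈-trans project₁ identityˡ) ⟩
    π₁ ∘ assʳ                                    ≈⟨ project₁ ⟩
    π₁ ∘ π₁                                      ∎
    where
    m : Y × (X × Y) ⇒ X × (Y × Y)
    m = assʳ ∘ (σ ×₁ id) ∘ assˡ

  -- `CD1` does not list projections, so `π₁` is written as `ρ⇒ ∘ (id ×₁ !)`: the unitor is linear
  -- and `CD5` differentiates the product map.
  D-π₁ : ∀ {X Y} → D (π₁ {X} {Y}) ≈ π₁ ∘ π₁
  D-π₁ = begin
    D π₁                            ≈⟨ D-cong (≈-trans project₁ identityˡ) ⟨
    D (ρ⇒ ∘ (id ×₁ !))              ≈⟨ D-linear-∘ D-ρ⇒ ⟩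
    π₁ ∘ D (id ×₁ !)                ≈⟨ ∘-congˡ CD5 ⟩
    π₁ ∘ (D id ×₁ D !) ∘ δ          ≈⟨ assoc ⟨
    (π₁ ∘ (D id ×₁ D !)) ∘ δ        ≈⟨ ∘-congʳ project₁ ⟩
    (D id ∘ π₁) ∘ δ                 ≈⟨ assoc ⟩
    D id ∘ (π₁ ∘ δ)                 ≈⟨ ∘-congʳ D-id ⟩
    π₁ ∘ (π₁ ∘ δ)                   ≈⟨ π₁-π₁-δ ⟩
    π₁ ∘ π₁                         ∎

  D-π₂ : ∀ {X Y} → D (π₂ {X} {Y}) ≈ π₂ ∘ π₁
  D-π₂ = begin
    D π₂                 ≈⟨ D-cong project₁ ⟨
    D (π₁ ∘ σ)           ≈⟨ D-linear-∘ D-π₁ ⟩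
    π₁ ∘ D σ             ≈⟨ ∘-congˡ (≈-trans CD1-σ project₁) ⟩
    π₁ ∘ (σ ∘ π₁)        ≈⟨ assoc ⟨
    (π₁ ∘ σ) ∘ π₁        ≈⟨ ∘-congʳ project₁ ⟩
    π₂ ∘ π₁              ∎

  -- Both projections are linear, so they read off the components of `D ⟨ f , g ⟩`, and uniqueness
  -- of pairing applies.
  D-⟨⟩ : ∀ {W X Y} {f : W ⇒ X} {g : W ⇒ Y} → D ⟨ f , g ⟩ ≈ ⟨ D f , D g ⟩
  D-⟨⟩ = ≈-sym (⟨⟩-unique
    (≈-trans (≈-sym (D-linear-∘ D-π₁)) (D-cong project₁))
    (≈-trans (≈-sym (D-linear-∘ D-π₂)) (D-cong project₂)))

-- Normalization by evaluation for pairings, projections and derivatives.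

module DifferentialSolver {o ℓ e} (C : CartesianDifferentialCategory o ℓ e) where
  open CartesianDifferentialCategory C
  open CartesianProperties cartesian
  open DifferentialProperties C

  infixr 7 _⊗_
  -- An abstract `Obj` cannot be matched on; the code fixes which products split into components and
  -- which objects stay atomic under `♯`.
  data Ty : Set o where
    ♯   : Obj → Ty
    𝟏   : Ty
    _⊗_ : Ty → Ty → Ty

  ⟦_⟧ᵗ : Ty → Obj
  ⟦ ♯ X ⟧ᵗ   = X
  ⟦ 𝟏 ⟧ᵗ     = 𝟙
  ⟦ S ⊗ T ⟧ᵗ = ⟦ S ⟧ᵗ × ⟦ T ⟧ᵗ

  infixr 9 _∘′_
  data Expr : Ty → Ty → Set (o ⊔ ℓ) where
    gen    : ∀ {S T} → ⟦ S ⟧ᵗ ⇒ ⟦ T ⟧ᵗ → Expr S T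
    id′    : ∀ {S} → Expr S S
    _∘′_   : ∀ {S T R} → Expr T R → Expr S T → Expr S R
    π₁′    : ∀ {S T} → Expr (S ⊗ T) S
    π₂′    : ∀ {S T} → Expr (S ⊗ T) T
    ⟨_,_⟩′ : ∀ {S T R} → Expr S T → Expr S R → Expr S (T ⊗ R)
    !′     : ∀ {S} → Expr S 𝟏
    D′     : ∀ {S T} → Expr S T → Expr (S ⊗ S) T

  ⟦_⟧ : ∀ {S T} → Expr S T → ⟦ S ⟧ᵗ ⇒ ⟦ T ⟧ᵗ
  ⟦ gen f ⟧      = f
  ⟦ id′ ⟧        = id
  ⟦ g ∘′ f ⟧     = ⟦ g ⟧ ∘ ⟦ f ⟧
  ⟦ π₁′ ⟧        = π₁
  ⟦ π₂′ ⟧        = π₂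
  ⟦ ⟨ f , g ⟩′ ⟧ = ⟨ ⟦ f ⟧ , ⟦ g ⟧ ⟩
  ⟦ !′ ⟧         = !
  ⟦ D′ f ⟧       = D ⟦ f ⟧

  infixr 8 _×′_
  _×′_ : ∀ {S S′ T T′} → Expr S S′ → Expr T T′ → Expr (S ⊗ T) (S′ ⊗ T′)
  f ×′ g = ⟨ f ∘′ π₁′ , g ∘′ π₂′ ⟩′

  -- η-long generalized elements at stage W.
  Val : Obj → Ty → Set ℓ
  Val W (♯ X)   = W ⇒ X
  Val W 𝟏       = ⊤
  Val W (S ⊗ T) = Val W S ∧ Val W T

  reify : ∀ {W} T → Val W T → W ⇒ ⟦ T ⟧ᵗ
  reify (♯ X)   x       = x
  reify 𝟏       _       = !
  reify (S ⊗ T) (x , y) = ⟨ reify S x , reify T y ⟩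

  reflect : ∀ {W} T → W ⇒ ⟦ T ⟧ᵗ → Val W T
  reflect (♯ X)   x = x
  reflect 𝟏       _ = tt
  reflect (S ⊗ T) x = reflect S (π₁ ∘ x) , reflect T (π₂ ∘ x)

  reify-reflect : ∀ {W} T (x : W ⇒ ⟦ T ⟧ᵗ) → reify T (reflect T x) ≈ x
  reify-reflect (♯ X)   x = ≈-refl
  reify-reflect 𝟏       x = !-unique₂
  reify-reflect (S ⊗ T) x =
    ≈-trans (⟨⟩-cong (reify-reflect S _) (reify-reflect T _)) ⟨⟩-η

  -- A second derivative stays an opaque morphism, which keeps evalD structurally
  -- recursive.
  eval  : ∀ {W S T} → Expr S T → Val W S → Val W T
  evalD : ∀ {W S T} → Expr S T → Val W (S ⊗ S) → Val W T

  eval {S = S} {T} (gen f) v = reflect T (f ∘ reify S v)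
  eval id′          v = v
  eval (g ∘′ f)     v = eval g (eval f v)
  eval π₁′          v = proj₁ v
  eval π₂′          v = proj₂ v
  eval ⟨ f , g ⟩′   v = eval f v , eval g v
  eval !′           v = tt
  eval (D′ f)       v = evalD f v

  evalD {S = S} {T} (gen f) v = reflect T (D f ∘ reify (S ⊗ S) v)
  evalD id′          v = proj₁ v
  evalD (g ∘′ f)     v = evalD g (evalD f v , eval f (proj₂ v))
  evalD π₁′          v = proj₁ (proj₁ v)
  evalD π₂′          v = proj₂ (proj₁ v)
  evalD ⟨ f , g ⟩′   v = evalD f v , evalD g v
  evalD !′           v = tt
  evalD {S = S} {T} (D′ f) v = reflect T (D (D ⟦ f ⟧) ∘ reify (S ⊗ S) v)

  eval-sound : ∀ {W S T} (f : Expr S T) (v : Val W S) →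
               reify T (eval f v) ≈ ⟦ f ⟧ ∘ reify S v
  evalD-sound : ∀ {W S T} (f : Expr S T) (v : Val W (S ⊗ S)) →
                reify T (evalD f v) ≈ D ⟦ f ⟧ ∘ reify (S ⊗ S) v

  eval-sound {T = T} (gen f) v = reify-reflect T _
  eval-sound id′        v = ≈-sym identityˡ
  eval-sound (g ∘′ f)   v = ≈-trans (eval-sound g (eval f v))
    (≈-trans (∘-congˡ (eval-sound f v)) (≈-sym assoc))
  eval-sound π₁′        v = ≈-sym project₁
  eval-sound π₂′        v = ≈-sym project₂
  eval-sound ⟨ f , g ⟩′ v =
    ≈-trans (⟨⟩-cong (eval-sound f v) (eval-sound g v)) (≈-sym ⟨⟩-∘)
  eval-sound !′         v = !-unique₂
  eval-sound (D′ f)     v = evalD-sound f v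

  evalD-sound {T = T} (gen f) v = reify-reflect T _
  evalD-sound {S = S} id′ v = ≈-sym (≈-trans (∘-congʳ D-id) project₁)
  -- Chain rule: the tangent passes through `D f`, the point `proj₂ v` through `f` itself. Hence the
  -- two soundness proofs are mutual.
  evalD-sound {S = S} (_∘′_ {T = T} {R} g f) v = begin
    reify R (evalD g (evalD f v , eval f (proj₂ v)))
      ≈⟨ evalD-sound g (evalD f v , eval f (proj₂ v)) ⟩
    D ⟦ g ⟧ ∘ ⟨ reify T (evalD f v) , reify T (eval f (proj₂ v)) ⟩
      ≈⟨ ∘-congˡ (⟨⟩-cong (evalD-sound f v) (eval-sound f (proj₂ v))) ⟩
    D ⟦ g ⟧ ∘ ⟨ D ⟦ f ⟧ ∘ reify (S ⊗ S) v , ⟦ f ⟧ ∘ reify S (proj₂ v) ⟩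
      ≈⟨ ∘-congˡ (⟨⟩-cong ≈-refl (∘-congˡ project₂)) ⟨
    D ⟦ g ⟧ ∘ ⟨ D ⟦ f ⟧ ∘ reify (S ⊗ S) v , ⟦ f ⟧ ∘ (π₂ ∘ reify (S ⊗ S) v) ⟩
      ≈⟨ ∘-congˡ (⟨⟩-cong ≈-refl assoc) ⟨
    D ⟦ g ⟧ ∘ ⟨ D ⟦ f ⟧ ∘ reify (S ⊗ S) v , (⟦ f ⟧ ∘ π₂) ∘ reify (S ⊗ S) v ⟩
      ≈⟨ ∘-congˡ ⟨⟩-∘ ⟨
    D ⟦ g ⟧ ∘ (⟨ D ⟦ f ⟧ , ⟦ f ⟧ ∘ π₂ ⟩ ∘ reify (S ⊗ S) v)
      ≈⟨ assoc ⟨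
    (D ⟦ g ⟧ ∘ ⟨ D ⟦ f ⟧ , ⟦ f ⟧ ∘ π₂ ⟩) ∘ reify (S ⊗ S) v
      ≈⟨ ∘-congʳ D-∘ ⟨
    D (⟦ g ⟧ ∘ ⟦ f ⟧) ∘ reify (S ⊗ S) v ∎
  evalD-sound π₁′ v = ≈-sym (≈-trans (∘-congʳ D-π₁)
    (≈-trans assoc (≈-trans (∘-congˡ project₁) project₁)))
  evalD-sound π₂′ v = ≈-sym (≈-trans (∘-congʳ D-π₂)
    (≈-trans assoc (≈-trans (∘-congˡ project₁) project₂)))
  evalD-sound ⟨ f , g ⟩′ v =
    ≈-trans (⟨⟩-cong (evalD-sound f v) (evalD-sound g v))
            (≈-trans (≈-sym ⟨⟩-∘) (∘-congʳ (≈-sym D-⟨⟩)))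
  evalD-sound !′ v = !-unique₂
  evalD-sound {T = T} (D′ f) v = reify-reflect T _

  -- The identity in η-long form is the generic element; the value there determines the morphism.
  nf : ∀ {S T} → Expr S T → Val ⟦ S ⟧ᵗ T
  nf {S} f = eval f (reflect S id)

  nf-sound : ∀ {S T} (f : Expr S T) → reify T (nf f) ≈ ⟦ f ⟧
  nf-sound {S} f =
    ≈-trans (eval-sound f (reflect S id))
            (≈-trans (∘-congˡ (reify-reflect S id)) identityʳ)

  -- In every use below the normal forms agree by computation, so `refl` suffices.
  solve : ∀ {S T} (f g : Expr S T) → nf f ≡ nf g → ⟦ f ⟧ ≈ ⟦ g ⟧
  solve {T = T} f g eq = ≈-trans (≈-sym (nf-sound f)) (≈-trans (≈-reflexive (cong (reify T) eq)) (nf-sound g))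

-- Derivatives of composite 2-cells and of unrollings.

module UnrollingDerivative {o ℓ e} (C : CartesianDifferentialCategory o ℓ e) where
  open Differential C
  open CartesianProperties cartesian
  open DifferentialSolver C

  ⨾-congˡ : ∀ {S S′ S″ X Y V W} {f g : TwoCell S X S′ Y} {h : TwoCell S′ V S″ W} →
            U f ≈ U g → U (f ⨾ h) ≈ U (g ⨾ h)
  ⨾-congˡ {f = f} {g} {h} p =
    ⟨⟩-cong (∘-congˡ s″w) (⟨⟩-cong (∘-congˡ s′y) (∘-congˡ s″w))
    where
    s′y : U f ∘ ⟨ π₁ , π₁ ∘ π₂ ⟩ ≈ U g ∘ ⟨ π₁ , π₁ ∘ π₂ ⟩
    s′y = ∘-congʳ p
    s″w : U h ∘ ⟨ π₁ ∘ (U f ∘ ⟨ π₁ , π₁ ∘ π₂ ⟩) , π₂ ∘ π₂ ⟩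
        ≈ U h ∘ ⟨ π₁ ∘ (U g ∘ ⟨ π₁ , π₁ ∘ π₂ ⟩) , π₂ ∘ π₂ ⟩
    s″w = ∘-congˡ (⟨⟩-cong (∘-congˡ s′y) ≈-refl)

  infixl 5 _⨾′_
  -- This and the next two are syntactic copies of the operations on cells, with definitionally
  -- equal interpretations, so `solve` yields equations about the originals.
  _⨾′_ : ∀ {S S′ S″ X Y V W} → Expr (S ⊗ X) (S′ ⊗ Y) → Expr (S′ ⊗ V) (S″ ⊗ W) →
         Expr (S ⊗ (X ⊗ V)) (S″ ⊗ (Y ⊗ W))
  f ⨾′ h = ⟨ π₁′ ∘′ s″w , ⟨ π₂′ ∘′ s′y , π₂′ ∘′ s″w ⟩′ ⟩′
    where
    s′y = f ∘′ ⟨ π₁′ , π₁′ ∘′ π₂′ ⟩′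
    s″w = h ∘′ ⟨ π₁′ ∘′ s′y , π₂′ ∘′ π₂′ ⟩′

  𝒟′ : ∀ {S S′ X Y} → Expr (S ⊗ X) (S′ ⊗ Y) →
       Expr ((S ⊗ S) ⊗ (X ⊗ X)) ((S′ ⊗ S′) ⊗ Y)
  𝒟′ f = ⟨ ⟨ π₁′ ∘′ ṡ′ẏ , π₁′ ∘′ f ∘′ point ⟩′ , π₂′ ∘′ ṡ′ẏ ⟩′
    where
    point = ⟨ π₂′ ∘′ π₁′ , π₂′ ∘′ π₂′ ⟩′
    ṡ′ẏ   = D′ f ∘′ ⟨ ⟨ π₁′ ∘′ π₁′ , π₁′ ∘′ π₂′ ⟩′ , point ⟩′

  _ᵛ′ : ∀ {S T} → Expr S T → Expr (S ⊗ 𝟏) (T ⊗ 𝟏)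
  f ᵛ′ = f ×′ id′

  module _ {A B : Seq} (f : StatefulSequence A B) where
    open StatefulSequence f

    -- Applying `𝒟` doubles the initial state `𝟙` to `𝟙 × 𝟙`, while the composite of `𝒟* f` again
    -- starts at `𝟙`; `⟨ ! , ! ⟩` bridges the two.
    composite-𝒟* : ∀ n → U (composite (𝒟* f) n) ≈
                   U (𝒟 (composite f n)) ∘ (⟨ ! , ! ⟩ ×₁ unzip A A n)
    composite-𝒟* zeroᴺ = solve
      ((π₁′ ∘′ 𝒟′ (i ᵛ′) ∘′ (λ⇐′ ×′ λ⇐′) ∘′ λ⇐′) ᵛ′)
      (𝒟′ (i ᵛ′) ∘′ (⟨ !′ , !′ ⟩′ ×′ ⟨ !′ , !′ ⟩′))
      refl
      where
      i : Expr 𝟏 (♯ (state 0))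
      i = gen init
      λ⇐′ : ∀ {T} → Expr T (𝟏 ⊗ T)
      λ⇐′ = ⟨ !′ , id′ ⟩′
    composite-𝒟* (suc n) = ≈-trans
      (⨾-congˡ {f = composite (𝒟* f) n}
               {g = cell (U (𝒟 (composite f n)) ∘ (⟨ ! , ! ⟩ ×₁ unzip A A n))}
               {h = 𝒟 (cells n)}
               (composite-𝒟* n))
      -- The chain rule feeds `D h` the tangent and the value of the intermediate state, exactly the
      -- two states passed on by `𝒟`.
      (solve
        ((𝒟′ c ∘′ (⟨ !′ {𝟏} , !′ ⟩′ ×′ z)) ⨾′ 𝒟′ h)
        (𝒟′ (c ⨾′ h) ∘′ (⟨ !′ , !′ ⟩′ ×′ unzip-suc))
        refl)
      where
      c : Expr (𝟏 ⊗ ♯ (∏ A n)) (♯ (state n) ⊗ ♯ (∏ B n))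
      c = gen (U (composite f n))
      h : Expr (♯ (state n) ⊗ ♯ (A n)) (♯ (state (suc n)) ⊗ ♯ (B n))
      h = gen (U (cells n))
      -- `unzip` at `n` stays opaque, but its codomain is coded as a pair; `unzip-suc` spells out
      -- one recursion step over it.
      z : Expr (♯ (∏ (A ×ˢ A) n)) (♯ (∏ A n) ⊗ ♯ (∏ A n))
      z = gen (unzip A A n)
      unzip-suc : Expr (♯ (∏ (A ×ˢ A) n) ⊗ (♯ (A n) ⊗ ♯ (A n)))
                       ((♯ (∏ A n) ⊗ ♯ (A n)) ⊗ (♯ (∏ A n) ⊗ ♯ (A n)))
      unzip-suc = ⟨ (π₁′ ∘′ z) ×′ π₁′ , (π₂′ ∘′ z) ×′ π₂′ ⟩′

  Un′ : ∀ {X S Y Z} → Expr (𝟏 ⊗ X) (S ⊗ (Y ⊗ Z)) → Expr X Z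
  Un′ c = π₂′ ∘′ π₁′ ∘′ π₂′ ∘′ (c ⨾′ (!′ ᵛ′)) ∘′ ⟨ !′ , id′ ⟩′ ∘′ ⟨ id′ , !′ ⟩′

  -- The closing cell only discards the final state, and the unitors only add or drop `𝟙`.
  Un-composite : ∀ {A B} (f : StatefulSequence A B) k →
                 Un k f ≈ π₂ ∘ π₂ ∘ U (composite f (suc k)) ∘ ⟨ ! , id ⟩
  Un-composite {A} {B} f k = solve (Un′ c) (π₂′ ∘′ π₂′ ∘′ c ∘′ ⟨ !′ , id′ ⟩′) refl
    where
    open StatefulSequence f
    c : Expr (𝟏 ⊗ ♯ (∏ A (suc k))) (♯ (state (suc k)) ⊗ (♯ (∏ B k) ⊗ ♯ (B k)))
    c = gen (U (composite f (suc k)))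

  Un-𝒟* : ∀ {A B} (f : StatefulSequence A B) k →
          Un k (𝒟* f) ≈ D (Un k f) ∘ unzip A A (suc k)
  Un-𝒟* {A} {B} f k = begin
    Un k (𝒟* f)
      ≈⟨ Un-composite (𝒟* f) k ⟩
    π₂ ∘ π₂ ∘ U (composite (𝒟* f) (suc k)) ∘ ⟨ ! , id ⟩
      ≈⟨ ∘-congˡ (∘-congˡ (∘-congʳ (composite-𝒟* f (suc k)))) ⟩
    π₂ ∘ π₂ ∘ (U (𝒟 (composite f (suc k))) ∘ (⟨ ! , ! ⟩ ×₁ unzip A A (suc k))) ∘ ⟨ ! , id ⟩
      -- The output of `𝒟` is the tangent output alone, so both sides are the last coordinate of `D`
      -- of the composite, taken at the unzipped inputs.
      ≈⟨ solve (π₂′ ∘′ π₂′ ∘′ (𝒟′ c ∘′ (⟨ !′ , !′ ⟩′ ×′ z)) ∘′ ⟨ !′ , id′ ⟩′)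
               (D′ (Un′ c) ∘′ z) refl ⟩
    D (Un k f) ∘ unzip A A (suc k) ∎
    where
    open StatefulSequence f
    c : Expr (𝟏 ⊗ ♯ (∏ A (suc k))) (♯ (state (suc k)) ⊗ (♯ (∏ B k) ⊗ ♯ (B k)))
    c = gen (U (composite f (suc k)))
    z : Expr (♯ (∏ (A ×ˢ A) (suc k))) (♯ (∏ A (suc k)) ⊗ ♯ (∏ A (suc k)))
    z = gen (unzip A A (suc k))

theorem39 : {o ℓ e : Level} (C : CartesianDifferentialCategory o ℓ e) →
    let open Differential C in
    (A B : Seq) (f : Setoid.Carrier (St A B)) (k : ℕ) →
    Un k (𝒟* f) ≈ D (Un k f) ∘ unzip A A (suc k)
theorem39 C A B f k = UnrollingDerivative.Un-𝒟* C f k
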